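{- Let $A$ and $B$ be disjoint sets with $|A|=a$, $|B|=b$ and $b\ge a$, and let $X=A\sqcup B$. Counting the cross inversions from $A$ to $B$ with respect to a ranking $\rho$ of $X$, i.e. computing $\mathrm{XInv}_\rho(A,B)$ from $\rho$, requires $\Omega((a+b)\log a)$ queries in the comparison-query model. The same lower bound holds for inversion minimization on the tree $T$ consisting of a root with two children, one of which has $a$ leaf children and the other of which has $b$ leaf children.
   Context: A ranking of a set $X$ of $n$ items is a bijection $\rho:X\to\{1,\dots,n\}$. For $A,B\subseteq X$, a cross inversion from $A$ to $B$ with respect to $\rho$ is a pair $(x_1,x_2)\in A\times B$ with $\rho(x_1)>\rho(x_2)$; their number is $\mathrm{XInv}_\rho(A,B)$. For a rooted tree $T$ with leaf set $X$, an ordering (left-to-right order of children at each internal node) induces a left-to-right ranking $\sigma$ of $X$; $\mathrm{MInv}(T,\rho)$ is the minimum over orderings of the number of pairs $x_1,x_2$ with $\rho(x_1)<\rho(x_2)$ and $\sigma(x_1)>\sigma(x_2)$. Inversion minimization on $T$: given $\rho$, output $\mathrm{MInv}(T,\rho)$. In the comparison-query model, an algorithm accesses $\rho$ only via queries "is $\rho(x_1)<\rho(x_2)$?"; the number of queries needed is the worst-case number of queries of the best correct deterministic algorithm. -}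

module Defs where

open import Data.Nat using (ℕ; zero; suc; _+_; _*_; _≤_; _<ᵇ_)
open import Data.Nat.Logarithm using (⌊log₂_⌋)
open import Data.Bool using (Bool; true; false; if_then_else_)
open import Data.Fin using (Fin; toℕ; _↑ˡ_; _↑ʳ_)
open import Data.Fin.Permutation using (Permutation′; _⟨$⟩ʳ_)
open import Data.List using (List; []; _∷_; _++_; map; allFin)
open import Data.Nat.ListAction using (sum)
open import Relation.Binary.PropositionalEquality using (_≡_)
open import Data.List.Relation.Binary.Pointwise using (Pointwise)
open import Data.List.Relation.Binary.Permutation.Propositional using (_↭_)
open import Data.Product using (Σ; _×_; _,_; ∃)

Ranking : ℕ → Set
Ranking n = Permutation′ n

_≺[_]_ : ∀ {n} → Fin n → Ranking n → Fin n → Bool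
x₁ ≺[ ρ ] x₂ = toℕ (ρ ⟨$⟩ʳ x₁) <ᵇ toℕ (ρ ⟨$⟩ʳ x₂)

countB : ∀ {X : Set} → (X → Bool) → List X → ℕ
countB p [] = 0
countB p (x ∷ xs) = if p x then suc (countB p xs) else countB p xs

-- Comparison-query model: deterministic adaptive algorithms are
-- decision trees whose internal nodes ask "is ρ(x₁) < ρ(x₂)?".

data DecTree (n : ℕ) (R : Set) : Set where
  leaf  : R → DecTree n R
  query : Fin n → Fin n → (yes no : DecTree n R) → DecTree n R

run : ∀ {n R} → DecTree n R → Ranking n → R
run (leaf r) ρ = r
run (query x₁ x₂ t u) ρ = if x₁ ≺[ ρ ] x₂ then run t ρ else run u ρ

queries : ∀ {n R} → DecTree n R → Ranking n → ℕ
queries (leaf r) ρ = 0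
queries (query x₁ x₂ t u) ρ =
  suc (if x₁ ≺[ ρ ] x₂ then queries t ρ else queries u ρ)

itemsA : (a b : ℕ) → List (Fin (a + b))
itemsA a b = map (λ i → i ↑ˡ b) (allFin a)

itemsB : (a b : ℕ) → List (Fin (a + b))
itemsB a b = map (λ j → a ↑ʳ j) (allFin b)

XInv : ∀ {n} → Ranking n → List (Fin n) → List (Fin n) → ℕ
XInv ρ A B = sum (map (λ x₁ → countB (λ x₂ → x₂ ≺[ ρ ] x₁) B) A)

data Tree (X : Set) : Set where
  lf   : X → Tree X
  node : List (Tree X) → Tree X

-- Leaves read left to right (the ranking σ induced by the ordering).
frontier : ∀ {X} → Tree X → List X
frontierL : ∀ {X} → List (Tree X) → List X
frontier (lf x) = x ∷ []
frontier (node ts) = frontierL ts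
frontierL [] = []
frontierL (t ∷ ts) = frontier t ++ frontierL ts

data Reordering {X : Set} : Tree X → Tree X → Set where
  lf   : ∀ x → Reordering (lf x) (lf x)
  node : ∀ {ts us vs} → Pointwise Reordering ts us → us ↭ vs →
         Reordering (node ts) (node vs)

invs : ∀ {n} → Ranking n → List (Fin n) → ℕ
invs ρ [] = 0
invs ρ (x₂ ∷ xs) = countB (λ x₁ → x₁ ≺[ ρ ] x₂) xs + invs ρ xs

IsMInv : ∀ {n} → Tree (Fin n) → Ranking n → ℕ → Set
IsMInv T ρ m =
  (Σ (Tree _) λ T' → Reordering T T' × invs ρ (frontier T') ≡ m)
  × (∀ T' → Reordering T T' → m ≤ invs ρ (frontier T'))

twoStar : (a b : ℕ) → Tree (Fin (a + b))
twoStar a b = node (node (map lf (itemsA a b)) ∷ node (map lf (itemsB a b)) ∷ [])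

XInvLowerBound : Set
XInvLowerBound =
  ∃ λ (c : ℕ) → ∃ λ (N : ℕ) → ∀ (a b : ℕ) → N ≤ a → a ≤ b →
    (alg : DecTree (a + b) ℕ) →
    (∀ ρ → run alg ρ ≡ XInv ρ (itemsA a b) (itemsB a b)) →
    ∃ λ (ρ : Ranking (a + b)) → (a + b) * ⌊log₂ a ⌋ ≤ c * queries alg ρ

MInvLowerBound : Set
MInvLowerBound =
  ∃ λ (c : ℕ) → ∃ λ (N : ℕ) → ∀ (a b : ℕ) → N ≤ a → a ≤ b →
    (alg : DecTree (a + b) ℕ) →
    (∀ ρ → IsMInv (twoStar a b) ρ (run alg ρ)) →
    ∃ λ (ρ : Ranking (a + b)) → (a + b) * ⌊log₂ a ⌋ ≤ c * queries alg ρ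

{-# OPTIONS --safe #-}

-- Exchanging two items of adjacent rank, one in A and one in B, changes XInv by one,
-- so the algorithm must compare every such pair directly.  Hence all rankings reaching
-- the same leaf of the decision tree agree on every comparison between A and B: if two
-- of them disagreed, adjacent exchanges consistent with the leaf would lead from one
-- ranking towards the other until a cross pair is exchanged.  Fix the order of A and
-- place each item of B into one of the top K ≈ a / 4 gaps.  The K ^ b resulting rankings
-- reach distinct leaves, so some path has length at least b log K.
--
-- All of these rankings have 2 XInv < a b, and for them MInv = min (XInv , a b − XInv)
-- is just XInv; this is why correctness is only ever assumed for 2 XInv ≤ a b.
module Submission where

open import Defs
open import Data.Bool using (Bool; true; false; if_then_else_)
import Data.Bool.Properties as Bool
open import Data.Empty using (⊥)
open import Data.Fin using (Fin; zero; suc; toℕ; fromℕ<; _↑ˡ_; _↑ʳ_; splitAt; punchOut; combine;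
  finToFun; funToFin)
open import Data.Fin.Properties using (_≟_; toℕ<n; toℕ-injective; toℕ-fromℕ<; any?;
  injective⇒≤; punchOut-injective; suc-injective; splitAt-↑ˡ; splitAt-↑ʳ; splitAt⁻¹-↑ˡ; splitAt⁻¹-↑ʳ;
  funToFin-finToFin; ↑ˡ-injective; ↑ʳ-injective)
open import Data.Fin.Permutation using (id; permutation; _⟨$⟩ʳ_; _⟨$⟩ˡ_; inverseʳ; inverseˡ; _∘ₚ_; transpose)
open import Data.List using (List; []; _∷_; _++_; map; allFin; tabulate; length; filter)
open import Data.List.Properties using (map-cong; map-tabulate; tabulate-cong; length-tabulate; ++-identityʳ; length-map)
open import Data.List.Relation.Binary.Permutation.Propositional
  using (_↭_; refl; prep; swap; trans; ↭-sym)
open import Data.List.Relation.Binary.Permutation.Propositional.Properties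
  using (map⁺; ↭-map-inv; ↭-singleton-inv; ↭-empty-inv)
open import Data.List.Relation.Binary.Pointwise using (Pointwise; []; _∷_)
open import Data.List.Relation.Unary.All as All using (All; []; _∷_)
import Data.List.Relation.Unary.All.Properties as All
open import Data.List.Relation.Unary.AllPairs using (AllPairs; []; _∷_)
import Data.List.Relation.Unary.AllPairs.Properties as AllPairs
import Data.List.Relation.Unary.Any as Any
open import Data.List.Relation.Unary.Sorted.TotalOrder.Properties using (Sorted⇒AllPairs)
import Data.List.Sort as Sort
open import Data.Nat using (ℕ; zero; suc; _+_; _*_; _∸_; _^_; _≤_; _<_; _<ᵇ_; z≤n; s≤s;
  ⌊_/2⌋; ⌈_/2⌉; _<?_; _≤?_)
open import Data.Nat.DivMod using (_%_; m<n⇒m%n≡m; [m+kn]%n≡m%n)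
open import Data.Nat.Induction using (<-rec)
open import Data.Nat.ListAction using (sum)
open import Data.Nat.ListAction.Properties using (sum-↭)
open import Data.Nat.Logarithm using (⌊log₂_⌋; ⌊log₂⌋-mono-≤; ⌊log₂⌊n/2⌋⌋≡⌊log₂n⌋∸1)
open import Data.Nat.Properties hiding (_≟_; suc-injective)
open import Algebra.Properties.CommutativeSemigroup +-commutativeSemigroup
  using (interchange; x∙yz≈y∙xz)
open import Data.Product using (_×_; _,_; ∃; proj₁; proj₂)
open import Data.Sum using (_⊎_; inj₁; inj₂; [_,_]′)
open import Data.Unit using (⊤; tt)
open import Function using (_∘_; Injective; Equivalence; const)
open import Relation.Binary using (DecTotalOrder; tri<; tri≈; tri>)
import Relation.Binary.Construct.On as On
open import Relation.Binary.PropositionalEquality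
  using (_≡_; _≢_; refl; sym; cong; cong₂; subst; subst₂; module ≡-Reasoning)
  renaming (trans to ≡-trans)
open import Relation.Nullary using (¬_; yes; no; contradiction)
open import Relation.Nullary.Decidable using (dec-true; dec-false)

-- Boolean comparison of natural numbers

<ᵇ-true : ∀ {m n} → m < n → (m <ᵇ n) ≡ true
<ᵇ-true m<n = Equivalence.to Bool.T-≡ (<⇒<ᵇ m<n)

<ᵇ-false : ∀ {m n} → n ≤ m → (m <ᵇ n) ≡ false
<ᵇ-false {m} {n} n≤m with m <ᵇ n in eq
... | false = refl
... | true  = contradiction (<ᵇ⇒< m n (Equivalence.from Bool.T-≡ eq)) (≤⇒≯ n≤m)

<ᵇ-cong : ∀ {m n k l} → (m < n → k < l) → (k < l → m < n) → (m <ᵇ n) ≡ (k <ᵇ l)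
<ᵇ-cong {m} {n} to from with m <? n
... | yes m<n = ≡-trans (<ᵇ-true m<n) (sym (<ᵇ-true (to m<n)))
... | no  m≮n = ≡-trans (<ᵇ-false (≮⇒≥ m≮n)) (sym (<ᵇ-false (≮⇒≥ (m≮n ∘ from))))

-- Sums over Fin n

∑ : ∀ {n} → (Fin n → ℕ) → ℕ
∑ f = sum (tabulate f)

⟦_⟧ : Bool → ℕ
⟦ b ⟧ = if b then 1 else 0

⟦⟧≤1 : ∀ b → ⟦ b ⟧ ≤ 1
⟦⟧≤1 false = z≤n
⟦⟧≤1 true  = s≤s z≤n

∑-cong : ∀ {n} {f g : Fin n → ℕ} → (∀ i → f i ≡ g i) → ∑ f ≡ ∑ g
∑-cong f≗g = cong sum (tabulate-cong f≗g)

∑-mono-≤ : ∀ {n} {f g : Fin n → ℕ} → (∀ i → f i ≤ g i) → ∑ f ≤ ∑ g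
∑-mono-≤ {zero}  f≤g = z≤n
∑-mono-≤ {suc n} f≤g = +-mono-≤ (f≤g zero) (∑-mono-≤ (f≤g ∘ suc))

∑-mono-< : ∀ {n} {f g : Fin n → ℕ} i → (∀ i → f i ≤ g i) → f i < g i → ∑ f < ∑ g
∑-mono-< zero    f≤g fi<gi = +-mono-<-≤ fi<gi (∑-mono-≤ (f≤g ∘ suc))
∑-mono-< (suc i) f≤g fi<gi = +-mono-≤-< (f≤g zero) (∑-mono-< i (f≤g ∘ suc) fi<gi)

∑-const : ∀ n c → ∑ {n} (const c) ≡ n * c
∑-const zero    c = refl
∑-const (suc n) c = cong (c +_) (∑-const n c)

∑-bound : ∀ {n} {f : Fin n → ℕ} c → (∀ i → f i ≤ c) → ∑ f ≤ n * c
∑-bound {n} c f≤c = ≤-trans (∑-mono-≤ f≤c) (≤-reflexive (∑-const n c))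

∑-suc : ∀ {n} {f g : Fin n → ℕ} i → f i ≡ suc (g i) → (∀ k → k ≢ i → f k ≡ g k) → ∑ f ≡ suc (∑ g)
∑-suc zero    fi≡ f≗g = cong₂ _+_ fi≡ (∑-cong (λ k → f≗g (suc k) λ ()))
∑-suc {g = g} (suc i) fi≡ f≗g = ≡-trans
  (cong₂ _+_ (f≗g zero λ ()) (∑-suc i fi≡ (λ k k≢i → f≗g (suc k) (k≢i ∘ suc-injective))))
  (+-suc (g zero) _)

-- Only indices with `n ≤ k + toℕ i` contribute, and there are at most `k` of them.
∑-tail-bound : ∀ {n} {f : Fin n → ℕ} k c → (∀ i → f i ≤ c) → (∀ i → k + toℕ i < n → f i ≡ 0) → ∑ f ≤ k * c
∑-tail-bound {zero}  k c f≤c f≡0 = z≤n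
∑-tail-bound {suc n} {f} k c f≤c f≡0 with k ≤? n
... | no  k≰n = ≤-trans (∑-bound c f≤c) (*-monoˡ-≤ c (≰⇒> k≰n))
... | yes k≤n = begin
  f zero + ∑ (f ∘ suc) ≡⟨ cong (_+ ∑ (f ∘ suc)) (f≡0 zero (s≤s (≤-trans (≤-reflexive (+-identityʳ k)) k≤n))) ⟩
  ∑ (f ∘ suc)          ≤⟨ ∑-tail-bound k c (f≤c ∘ suc) (λ i lt → f≡0 (suc i) (≤-trans (s≤s (≤-reflexive (+-suc k (toℕ i)))) (s≤s lt))) ⟩
  k * c                ∎
  where open ≤-Reasoning

countB-tabulate : ∀ {X : Set} {n} (p : X → Bool) (f : Fin n → X) → countB p (tabulate f) ≡ ∑ (λ i → ⟦ p (f i) ⟧)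
countB-tabulate {n = zero}  p f = refl
countB-tabulate {n = suc n} p f with p (f zero)
... | true  = cong suc (countB-tabulate p (f ∘ suc))
... | false = countB-tabulate p (f ∘ suc)

XInv-∑ : ∀ a b (ρ : Ranking (a + b)) →
  XInv ρ (itemsA a b) (itemsB a b) ≡ ∑ {a} (λ i → ∑ {b} (λ j → ⟦ (a ↑ʳ j) ≺[ ρ ] (i ↑ˡ b) ⟧))
XInv-∑ a b ρ = begin
  sum (map F (map (_↑ˡ b) (allFin a)))   ≡⟨ cong (λ xs → sum (map F xs)) (map-tabulate {n = a} (λ i → i) (_↑ˡ b)) ⟩
  sum (map F (tabulate {n = a} (_↑ˡ b))) ≡⟨ cong sum (map-tabulate {n = a} (_↑ˡ b) F) ⟩
  ∑ {a} (λ i → F (i ↑ˡ b))               ≡⟨ ∑-cong {a} (λ i → row (i ↑ˡ b)) ⟩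
  ∑ {a} (λ i → ∑ {b} (λ j → ⟦ (a ↑ʳ j) ≺[ ρ ] (i ↑ˡ b) ⟧)) ∎
  where
  open ≡-Reasoning
  F : Fin (a + b) → ℕ
  F x₁ = countB (λ x₂ → x₂ ≺[ ρ ] x₁) (itemsB a b)
  row : ∀ x → F x ≡ ∑ {b} (λ j → ⟦ (a ↑ʳ j) ≺[ ρ ] x ⟧)
  row x = ≡-trans (cong (countB (_≺[ ρ ] x)) (map-tabulate {n = b} (λ j → j) (a ↑ʳ_)))
                  (countB-tabulate (_≺[ ρ ] x) (a ↑ʳ_))

-- Rankings

pos : ∀ {n} → Ranking n → Fin n → ℕ
pos ρ x = toℕ (ρ ⟨$⟩ʳ x)

pos-injective : ∀ {n} (ρ : Ranking n) {x y} → pos ρ x ≡ pos ρ y → x ≡ y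
pos-injective ρ {x} {y} eq =
  ≡-trans (sym (inverseˡ ρ)) (≡-trans (cong (ρ ⟨$⟩ˡ_) (toℕ-injective eq)) (inverseˡ ρ))

itemAt : ∀ {n} (ρ : Ranking n) {m} → m < n → ∃ λ x → pos ρ x ≡ m
itemAt ρ m<n = ρ ⟨$⟩ˡ fromℕ< m<n , ≡-trans (cong toℕ (inverseʳ ρ)) (toℕ-fromℕ< m<n)

predecessor : ∀ {n} (ρ : Ranking n) {v m} → m < pos ρ v → ∃ λ z → pos ρ v ≡ suc (pos ρ z)
predecessor ρ {v} m<v with pos ρ v in eq | m<v
... | suc k | _ with itemAt ρ (<-trans (n<1+n k) (subst (_< _) eq (toℕ<n (ρ ⟨$⟩ʳ v))))
...   | z , pos-z = z , cong suc (sym pos-z)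

-- Pigeonhole: if `y` were missed, punching it out of the codomain would give an injection of
-- `Fin (suc n)` into `Fin n`.
injective⇒surjective : ∀ {n} {f : Fin n → Fin n} → Injective _≡_ _≡_ f → ∀ y → ∃ λ x → f x ≡ y
injective⇒surjective {zero}      inj ()
injective⇒surjective {suc n} {f} inj y with any? (λ x → f x ≟ y)
... | yes hit  = hit
... | no  miss = contradiction (injective⇒≤ {f = g} g-injective) 1+n≰n
  where
  y≢f : ∀ x → y ≢ f x
  y≢f x y≡fx = miss (x , sym y≡fx)
  g : Fin (suc n) → Fin n
  g x = punchOut (y≢f x)
  g-injective : Injective _≡_ _≡_ g
  g-injective {x} {x′} = inj ∘ punchOut-injective (y≢f x) (y≢f x′)

-- Turns an injective key into a ranking: the rank of an item is the number of items with a smaller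
-- key, and injectivity on a finite set supplies the inverse.
module KeyRanking {n} (key : Fin n → ℕ) (key-injective : ∀ {x y} → key x ≡ key y → x ≡ y) where

  private
    below : Fin n → Fin n → ℕ
    below x y = ⟦ key y <ᵇ key x ⟧

    below-self : ∀ x → below x x ≡ 0
    below-self x = cong ⟦_⟧ (<ᵇ-false (≤-refl {key x}))

    rank<n : ∀ x → ∑ (below x) < n
    rank<n x = begin-strict
      ∑ (below x)    <⟨ ∑-mono-< x (λ y → ⟦⟧≤1 (key y <ᵇ key x)) (s≤s (≤-reflexive (below-self x))) ⟩
      ∑ {n} (const 1)    ≡⟨ ∑-const n 1 ⟩
      n * 1          ≡⟨ *-identityʳ n ⟩
      n              ∎
      where open ≤-Reasoning

    rank : Fin n → Fin n
    rank x = fromℕ< (rank<n x)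

    rank-mono : ∀ {x y} → key x < key y → toℕ (rank x) < toℕ (rank y)
    rank-mono {x} {y} x<y = begin-strict
      toℕ (rank x)   ≡⟨ toℕ-fromℕ< (rank<n x) ⟩
      ∑ (below x)    <⟨ ∑-mono-< x below-mono (≤-reflexive (≡-trans (cong suc (below-self x)) (sym (cong ⟦_⟧ (<ᵇ-true x<y))))) ⟩
      ∑ (below y)    ≡⟨ toℕ-fromℕ< (rank<n y) ⟨
      toℕ (rank y)   ∎
      where
      open ≤-Reasoning
      below-mono : ∀ z → below x z ≤ below y z
      below-mono z with key z <? key x
      ... | yes z<x = ≤-reflexive (cong ⟦_⟧ (≡-trans (<ᵇ-true z<x) (sym (<ᵇ-true (<-trans z<x x<y)))))
      ... | no  z≮x = ≤-trans (≤-reflexive (cong ⟦_⟧ (<ᵇ-false (≮⇒≥ z≮x)))) z≤n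

    rank-injective : Injective _≡_ _≡_ rank
    rank-injective {x} {y} eq with <-cmp (key x) (key y)
    ... | tri< x<y _ _ = contradiction (cong toℕ eq) (<⇒≢ (rank-mono x<y))
    ... | tri≈ _ x≡y _ = key-injective x≡y
    ... | tri> _ _ y<x = contradiction (cong toℕ (sym eq)) (<⇒≢ (rank-mono y<x))

    unrank : ∀ y → ∃ λ x → rank x ≡ y
    unrank = injective⇒surjective rank-injective

  ranking : Ranking n
  ranking = permutation rank (proj₁ ∘ unrank) (proj₂ ∘ unrank) (λ x → rank-injective (proj₂ (unrank (rank x))))

  pos-mono : ∀ {x y} → key x < key y → pos ranking x < pos ranking y
  pos-mono = rank-mono

-- Decision trees

-- The answers of `ρ` choose the branch, and the equation at each query makes `ρ′` follow. Stated
-- this way, the agreement on any pair compared along the path can be read off directly.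
SameLeaf : ∀ {n R} → DecTree n R → Ranking n → Ranking n → Set
SameLeaf (leaf r) ρ ρ′ = ⊤
SameLeaf (query x y t u) ρ ρ′ =
  (x ≺[ ρ ] y ≡ x ≺[ ρ′ ] y) × (if x ≺[ ρ ] y then SameLeaf t ρ ρ′ else SameLeaf u ρ ρ′)

SameLeaf-sym : ∀ {n R} (t : DecTree n R) {ρ ρ′} → SameLeaf t ρ ρ′ → SameLeaf t ρ′ ρ
SameLeaf-sym (leaf r) s = tt
SameLeaf-sym (query x y t u) {ρ} {ρ′} (eq , s) with x ≺[ ρ ] y | x ≺[ ρ′ ] y | eq
... | true  | _ | refl = refl , SameLeaf-sym t s
... | false | _ | refl = refl , SameLeaf-sym u s

run-SameLeaf : ∀ {n R} (t : DecTree n R) {ρ ρ′} → SameLeaf t ρ ρ′ → run t ρ ≡ run t ρ′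
run-SameLeaf (leaf r) s = refl
run-SameLeaf (query x y t u) {ρ} {ρ′} (eq , s) with x ≺[ ρ ] y | x ≺[ ρ′ ] y | eq
... | true  | _ | refl = run-SameLeaf t s
... | false | _ | refl = run-SameLeaf u s

filterBy : ∀ {X : Set} → (X → Bool) → Bool → List X → List X
filterBy p b = filter (λ x → p x Bool.≟ b)

length-filterBy : ∀ {X : Set} (p : X → Bool) xs →
  length xs ≡ length (filterBy p true xs) + length (filterBy p false xs)
length-filterBy p [] = refl
length-filterBy p (x ∷ xs) with p x
... | true  = cong suc (length-filterBy p xs)
... | false = ≡-trans (cong suc (length-filterBy p xs)) (sym (+-suc _ _))

-- The answer to the root query splits the list in two, and each half has paths shorter by one in
-- its branch. The depth bound concerns only the listed rankings; the tree itself may be deeper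
-- elsewhere.
depth-lower-bound : ∀ {n R} (t : DecTree n R) d (ρs : List (Ranking n)) →
  All (λ ρ → queries t ρ ≤ d) ρs → AllPairs (λ ρ ρ′ → ¬ SameLeaf t ρ ρ′) ρs →
  length ρs ≤ 2 ^ d
depth-lower-bound (leaf r) d [] _ _ = z≤n
depth-lower-bound (leaf r) d (ρ ∷ []) _ _ = m^n>0 2 d
depth-lower-bound (leaf r) d (ρ ∷ ρ′ ∷ ρs) _ ((ρ≁ρ′ ∷ _) ∷ _) = contradiction tt ρ≁ρ′
depth-lower-bound (query x y t u) d [] _ _ = z≤n
depth-lower-bound (query x y t u) zero (ρ ∷ ρs) (() ∷ _) _
depth-lower-bound {n} {R} (query x y t u) (suc d) ρs@(_ ∷ _) shallow distinct = begin
  length ρs                                                     ≡⟨ length-filterBy p ρs ⟩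
  length (filterBy p true ρs) + length (filterBy p false ρs)    ≤⟨ +-mono-≤ (half true) (half false) ⟩
  2 ^ d + 2 ^ d                                                 ≡⟨ cong (2 ^ d +_) (+-identityʳ (2 ^ d)) ⟨
  2 ^ suc d                                                     ∎
  where
  open ≤-Reasoning
  p : Ranking n → Bool
  p ρ = x ≺[ ρ ] y

  branch : Bool → DecTree n R
  branch b = if b then t else u

  shallow-branch : ∀ b {ρ} → p ρ ≡ b → queries (query x y t u) ρ ≤ suc d → queries (branch b) ρ ≤ d
  shallow-branch true  eq (s≤s q) rewrite eq = q
  shallow-branch false eq (s≤s q) rewrite eq = q

  join : ∀ b {ρ ρ′} → p ρ ≡ b → p ρ′ ≡ b → SameLeaf (branch b) ρ ρ′ → SameLeaf (query x y t u) ρ ρ′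
  join true  eq eq′ s rewrite eq | eq′ = refl , s
  join false eq eq′ s rewrite eq | eq′ = refl , s

  distinct-branch : ∀ b {σs} → All (λ ρ → p ρ ≡ b) σs →
    AllPairs (λ ρ ρ′ → ¬ SameLeaf (query x y t u) ρ ρ′) σs →
    AllPairs (λ ρ ρ′ → ¬ SameLeaf (branch b) ρ ρ′) σs
  distinct-branch b [] [] = []
  distinct-branch b (pρ ∷ pσs) (ρ≁ ∷ σs≁) =
    All.zipWith (λ (pρ′ , ≁) s → ≁ (join b pρ pρ′ s)) (pσs , ρ≁) ∷ distinct-branch b pσs σs≁

  half : ∀ b → length (filterBy p b ρs) ≤ 2 ^ d
  half b = depth-lower-bound (branch b) d (filterBy p b ρs)
    (All.zipWith (λ (eq , q) → shallow-branch b eq q) (all-p , All.filter⁺ p≟b shallow))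
    (distinct-branch b all-p (AllPairs.filter⁺ p≟b distinct))
    where
    p≟b = λ ρ → p ρ Bool.≟ b
    all-p = All.all-filter p≟b ρs

-- If every listed ranking used fewer than `d` queries, at most `2 ^ (d ∸ 1)` of them could reach
-- distinct leaves.
worst-case-lower-bound : ∀ {n R} (t : DecTree n R) {d} (ρ₀ : Ranking n) (ρs : List (Ranking n)) →
  2 ^ d ≤ length ρs → AllPairs (λ ρ ρ′ → ¬ SameLeaf t ρ ρ′) ρs →
  ∃ λ ρ → d ≤ queries t ρ
-- With `d = 0` any ranking will do; `ρ₀` is the default witness.
worst-case-lower-bound t {zero}  ρ₀ ρs _ _ = ρ₀ , z≤n
worst-case-lower-bound t {suc d} ρ₀ ρs many distinct
  with All.decide (λ ρ → ≤-<-connex (queries t ρ) d) ρs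
... | inj₂ deep    = Any.satisfied deep
... | inj₁ shallow = contradiction
  (≤-trans many (depth-lower-bound t d ρs shallow distinct))
  (<⇒≱ (^-monoʳ-< 2 (s≤s (s≤s z≤n)) (n<1+n d)))

-- Adjacent transpositions

module _ {n} (ρ : Ranking n) (u v : Fin n) where

  -- The transposition acts on ranks, since `∘ₚ` applies `ρ` first.
  exchange : Ranking n
  exchange = ρ ∘ₚ transpose (ρ ⟨$⟩ʳ u) (ρ ⟨$⟩ʳ v)

  pos-exchange₁ : pos exchange u ≡ pos ρ v
  pos-exchange₁ rewrite dec-true ((ρ ⟨$⟩ʳ u) ≟ (ρ ⟨$⟩ʳ u)) refl = refl

  pos-exchange₂ : pos exchange v ≡ pos ρ u
  pos-exchange₂ with (ρ ⟨$⟩ʳ v) ≟ (ρ ⟨$⟩ʳ u)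
  ... | yes v≡u = cong toℕ v≡u
  ... | no  _ rewrite dec-true ((ρ ⟨$⟩ʳ v) ≟ (ρ ⟨$⟩ʳ v)) refl = refl

  pos-exchange-other : ∀ {x} → x ≢ u → x ≢ v → pos exchange x ≡ pos ρ x
  pos-exchange-other {x} x≢u x≢v
    rewrite dec-false ((ρ ⟨$⟩ʳ x) ≟ (ρ ⟨$⟩ʳ u)) (x≢u ∘ pos-injective ρ ∘ cong toℕ)
          | dec-false ((ρ ⟨$⟩ʳ x) ≟ (ρ ⟨$⟩ʳ v)) (x≢v ∘ pos-injective ρ ∘ cong toℕ) = refl

  module _ (adjacent : pos ρ v ≡ suc (pos ρ u)) where

    -- No third item has a rank between those of `u` and `v`, so each third item compares with both
    -- in the same way, before and after the exchange.
    ≺-exchange : ∀ x y → ¬ (x ≡ u × y ≡ v) → ¬ (x ≡ v × y ≡ u) → x ≺[ ρ ] y ≡ x ≺[ exchange ] y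
    ≺-exchange x y ¬uv ¬vu with x ≟ u | x ≟ v | y ≟ u | y ≟ v
    ... | yes refl | _        | yes refl | _        = ≡-trans (<ᵇ-false (≤-refl {pos ρ u})) (sym (<ᵇ-false (≤-refl {pos exchange u})))
    ... | yes refl | _        | no _     | yes refl = contradiction (refl , refl) ¬uv
    ... | yes refl | _        | no y≢u   | no y≢v
      rewrite pos-exchange₁ | pos-exchange-other y≢u y≢v | adjacent =
      <ᵇ-cong (λ u<y → ≤∧≢⇒< u<y (λ eq → y≢v (pos-injective ρ (≡-trans (sym eq) (sym adjacent))))) (<-trans (n<1+n _))
    ... | no x≢u   | yes refl | yes refl | _        = contradiction (refl , refl) ¬vu
    ... | no x≢u   | yes refl | no _     | yes refl = ≡-trans (<ᵇ-false (≤-refl {pos ρ v})) (sym (<ᵇ-false (≤-refl {pos exchange v})))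
    ... | no x≢u   | yes refl | no y≢u   | no y≢v
      rewrite pos-exchange₂ | pos-exchange-other y≢u y≢v | adjacent =
      <ᵇ-cong (<-trans (n<1+n _)) (λ u<y → ≤∧≢⇒< u<y (λ eq → y≢v (pos-injective ρ (≡-trans (sym eq) (sym adjacent)))))
    ... | no x≢u   | no x≢v   | yes refl | _
      rewrite pos-exchange₁ | pos-exchange-other x≢u x≢v | adjacent =
      <ᵇ-cong (λ x<u → <-trans x<u (n<1+n _)) (λ x<v → ≤∧≢⇒< (≤-pred x<v) (x≢u ∘ pos-injective ρ))
    ... | no x≢u   | no x≢v   | no y≢u   | yes refl
      rewrite pos-exchange₂ | pos-exchange-other x≢u x≢v | adjacent =
      <ᵇ-cong (λ x<v → ≤∧≢⇒< (≤-pred x<v) (x≢u ∘ pos-injective ρ)) (λ x<u → <-trans x<u (n<1+n _))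
    ... | no x≢u   | no x≢v   | no y≢u   | no y≢v
      rewrite pos-exchange-other x≢u x≢v | pos-exchange-other y≢u y≢v = refl

    u≺v : u ≺[ ρ ] v ≡ true
    u≺v = <ᵇ-true (≤-reflexive (sym adjacent))

    v⊀u : v ≺[ ρ ] u ≡ false
    v⊀u = <ᵇ-false (≤-trans (n≤1+n _) (≤-reflexive (sym adjacent)))

    v≺u-exchange : v ≺[ exchange ] u ≡ true
    v≺u-exchange rewrite pos-exchange₁ | pos-exchange₂ = u≺v

    u⊀v-exchange : u ≺[ exchange ] v ≡ false
    u⊀v-exchange rewrite pos-exchange₁ | pos-exchange₂ = v⊀u

    -- ρ and ρ′ order u and v differently, so the path to their common leaf does
    -- not compare u with v; every other comparison is unaffected.
    SameLeaf-exchange : ∀ {R} (t : DecTree n R) {ρ′} → pos ρ′ v < pos ρ′ u →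
      SameLeaf t ρ ρ′ → SameLeaf t exchange ρ′
    SameLeaf-exchange (leaf r) v<u s = tt
    SameLeaf-exchange (query x y t r) {ρ′} v<u (eq , s) = ≡-trans (sym same) eq , branch
      where
      same : x ≺[ ρ ] y ≡ x ≺[ exchange ] y
      same = ≺-exchange x y
        (λ { (refl , refl) → contradiction (≡-trans (sym u≺v) (≡-trans eq (<ᵇ-false (<⇒≤ v<u)))) λ () })
        (λ { (refl , refl) → contradiction (≡-trans (sym v⊀u) (≡-trans eq (<ᵇ-true v<u))) λ () })
      branch : if x ≺[ exchange ] y then SameLeaf t exchange ρ′ else SameLeaf r exchange ρ′
      branch rewrite sym same with x ≺[ ρ ] y
      ... | true  = SameLeaf-exchange t v<u s
      ... | false = SameLeaf-exchange r v<u s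

-- Cross inversions under adjacent exchanges

module Cross (a b : ℕ) where

  X : Ranking (a + b) → ℕ
  X ρ = XInv ρ (itemsA a b) (itemsB a b)

  inA : Fin (a + b) → Bool
  inA x = [ const true , const false ]′ (splitAt a x)

  inA-↑ˡ : ∀ i → inA (i ↑ˡ b) ≡ true
  inA-↑ˡ i rewrite splitAt-↑ˡ a i b = refl

  inA-↑ʳ : ∀ j → inA (a ↑ʳ j) ≡ false
  inA-↑ʳ j rewrite splitAt-↑ʳ a b j = refl

  inA-true : ∀ x → inA x ≡ true → ∃ λ i → x ≡ i ↑ˡ b
  inA-true x eq with splitAt a x in split
  inA-true x refl | inj₁ i = i , sym (splitAt⁻¹-↑ˡ split)

  inA-false : ∀ x → inA x ≡ false → ∃ λ j → x ≡ a ↑ʳ j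
  inA-false x eq with splitAt a x in split
  inA-false x refl | inj₂ j = j , sym (splitAt⁻¹-↑ʳ {a} split)

  inA-≢ : ∀ {x y} → inA x ≢ inA y → x ≢ y
  inA-≢ x≁y refl = x≁y refl

  X-cong : ∀ ρ ρ′ → (∀ x y → inA x ≡ true → inA y ≡ false → y ≺[ ρ ] x ≡ y ≺[ ρ′ ] x) → X ρ ≡ X ρ′
  X-cong ρ ρ′ same = begin
    X ρ                                                           ≡⟨ XInv-∑ a b ρ ⟩
    ∑ {a} (λ i → ∑ {b} (λ j → ⟦ (a ↑ʳ j) ≺[ ρ ] (i ↑ˡ b) ⟧))      ≡⟨ ∑-cong {a} (λ i → ∑-cong {b} (λ j →
                                                                       cong ⟦_⟧ (same (i ↑ˡ b) (a ↑ʳ j) (inA-↑ˡ i) (inA-↑ʳ j)))) ⟩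
    ∑ {a} (λ i → ∑ {b} (λ j → ⟦ (a ↑ʳ j) ≺[ ρ′ ] (i ↑ˡ b) ⟧))     ≡⟨ XInv-∑ a b ρ′ ⟨
    X ρ′                                                          ∎
    where open ≡-Reasoning

  -- The two rankings differ on a single cross pair, hence in a single summand of the double sum.
  -- Keeping `ρ` and `ρ′` general serves exchanges in both directions.
  X-increment : ∀ ρ ρ′ x y → inA x ≡ true → inA y ≡ false →
    y ≺[ ρ ] x ≡ false → y ≺[ ρ′ ] x ≡ true →
    (∀ x′ y′ → inA x′ ≡ true → inA y′ ≡ false → ¬ (x′ ≡ x × y′ ≡ y) → y′ ≺[ ρ ] x′ ≡ y′ ≺[ ρ′ ] x′) →
    X ρ′ ≡ suc (X ρ)
  X-increment ρ ρ′ x y x∈A y∈B y⊀x y≺x same with inA-true x x∈A | inA-false y y∈B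
  ... | i , refl | j , refl = begin
    X ρ′             ≡⟨ XInv-∑ a b ρ′ ⟩
    ∑ {a} (λ i → ∑ {b} (λ j → ⟦ (a ↑ʳ j) ≺[ ρ′ ] (i ↑ˡ b) ⟧))
      ≡⟨ ∑-suc i
           (∑-suc j (≡-trans (cong ⟦_⟧ y≺x) (cong (suc ∘ ⟦_⟧) (sym y⊀x))) (λ k k≢j →
             unchanged i k (k≢j ∘ ↑ʳ-injective a k j ∘ proj₂)))
           (λ k k≢i → ∑-cong {b} (λ l → unchanged k l (k≢i ∘ ↑ˡ-injective b k i ∘ proj₁))) ⟩
    suc (∑ {a} (λ i → ∑ {b} (λ j → ⟦ (a ↑ʳ j) ≺[ ρ ] (i ↑ˡ b) ⟧)))
      ≡⟨ cong suc (XInv-∑ a b ρ) ⟨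
    suc (X ρ)        ∎
    where
    open ≡-Reasoning
    unchanged : ∀ k l → ¬ (k ↑ˡ b ≡ i ↑ˡ b × a ↑ʳ l ≡ a ↑ʳ j) →
      ⟦ (a ↑ʳ l) ≺[ ρ′ ] (k ↑ˡ b) ⟧ ≡ ⟦ (a ↑ʳ l) ≺[ ρ ] (k ↑ˡ b) ⟧
    unchanged k l ≢ij = cong ⟦_⟧ (sym (same (k ↑ˡ b) (a ↑ʳ l) (inA-↑ˡ k) (inA-↑ʳ l) ≢ij))

  module _ (ρ : Ranking (a + b)) (u v : Fin (a + b)) (adjacent : pos ρ v ≡ suc (pos ρ u)) where

    X-exchange-same : inA u ≡ inA v → X (exchange ρ u v) ≡ X ρ
    X-exchange-same u~v = X-cong (exchange ρ u v) ρ λ x y x∈A y∈B → sym (≺-exchange ρ u v adjacent y x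
      (λ { (refl , refl) → contradiction (≡-trans (sym x∈A) (≡-trans (sym u~v) y∈B)) λ () })
      (λ { (refl , refl) → contradiction (≡-trans (sym x∈A) (≡-trans u~v y∈B)) λ () }))

    X-exchange-AB : inA u ≡ true → inA v ≡ false → X (exchange ρ u v) ≡ suc (X ρ)
    X-exchange-AB u∈A v∈B = X-increment ρ (exchange ρ u v) u v u∈A v∈B
      (v⊀u ρ u v adjacent) (v≺u-exchange ρ u v adjacent)
      λ x y x∈A y∈B ≢uv → ≺-exchange ρ u v adjacent y x
        (λ { (refl , refl) → contradiction (≡-trans (sym x∈A) v∈B) λ () })
        (λ { (refl , refl) → ≢uv (refl , refl) })

    X-exchange-BA : inA u ≡ false → inA v ≡ true → X ρ ≡ suc (X (exchange ρ u v))
    X-exchange-BA u∈B v∈A = X-increment (exchange ρ u v) ρ v u v∈A u∈B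
      (u⊀v-exchange ρ u v adjacent) (u≺v ρ u v adjacent)
      λ x y x∈A y∈B ≢vu → sym (≺-exchange ρ u v adjacent y x
        (λ { (refl , refl) → ≢vu (refl , refl) })
        (λ { (refl , refl) → contradiction (≡-trans (sym x∈A) u∈B) λ () }))

  -- Rankings that reach the same leaf agree on cross pairs

  module _ (t : DecTree (a + b) ℕ) (correct : ∀ ρ → 2 * X ρ ≤ a * b → run t ρ ≡ X ρ) where

    -- Both `ρ` and its exchange reach the leaf of `ρ′`, so the algorithm gives one answer for the
    -- two; smallness of each makes that answer its number of cross inversions.
    run-exchange : ∀ {ρ ρ′ u v} → pos ρ v ≡ suc (pos ρ u) → pos ρ′ v < pos ρ′ u → SameLeaf t ρ ρ′ →
      2 * X ρ ≤ a * b → 2 * X (exchange ρ u v) ≤ a * b → X ρ ≡ X (exchange ρ u v)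
    run-exchange {ρ} {ρ′} {u} {v} adjacent v<u s small small′ = begin
      X ρ                    ≡⟨ correct ρ small ⟨
      run t ρ                ≡⟨ run-SameLeaf t s ⟩
      run t ρ′               ≡⟨ run-SameLeaf t (SameLeaf-exchange ρ u v adjacent t v<u s) ⟨
      run t (exchange ρ u v) ≡⟨ correct (exchange ρ u v) small′ ⟩
      X (exchange ρ u v)     ∎
      where open ≡-Reasoning

    -- Otherwise `run-exchange` would equate two counts that differ by one. The slack of 2 in the
    -- hypothesis keeps the exchanged ranking small even when the exchange adds a cross inversion.
    adjacent-cross-agree : ∀ {ρ ρ′ u v} → 2 + 2 * X ρ ≤ a * b → SameLeaf t ρ ρ′ →
      inA u ≢ inA v → pos ρ v ≡ suc (pos ρ u) → ¬ (pos ρ′ v < pos ρ′ u)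
    adjacent-cross-agree {ρ} {ρ′} {u} {v} small s u≁v adjacent v<u with inA u in u? | inA v in v?
    ... | true  | true  = u≁v refl
    ... | false | false = u≁v refl
    ... | true  | false = <⇒≢ (n<1+n (X ρ)) (≡-trans unchanged changed)
      where
      changed = X-exchange-AB ρ u v adjacent u? v?
      unchanged = run-exchange adjacent v<u s (m+n≤o⇒n≤o 2 small)
        (≤-trans (≤-reflexive (≡-trans (cong (2 *_) changed) (*-suc 2 (X ρ)))) small)
    ... | false | true  = <⇒≢ (n<1+n (X (exchange ρ u v))) (≡-trans (sym unchanged) changed)
      where
      changed = X-exchange-BA ρ u v adjacent u? v?
      unchanged = run-exchange adjacent v<u s (m+n≤o⇒n≤o 2 small)
        (≤-trans (*-monoʳ-≤ 2 (≤-trans (n≤1+n _) (≤-reflexive (sym changed)))) (m+n≤o⇒n≤o 2 small))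

    -- Induction on the distance d between u and v in ρ.  Let w be the successor of u
    -- and z the predecessor of v.  If w lies on the side of u, then either u can move
    -- past w or w can replace u; likewise for z and v.  Otherwise z <′ v <′ u <′ w
    -- with w and z on different sides, so the pair (w , z) can replace (u , v).
    cross-agree-within : ∀ d ρ {ρ′ u v} → pos ρ v ≤ d + pos ρ u → 2 + 2 * X ρ ≤ a * b → SameLeaf t ρ ρ′ →
      inA u ≢ inA v → pos ρ u < pos ρ v → ¬ (pos ρ′ v < pos ρ′ u)
    cross-agree-within zero ρ near small s u≁v u<v v<′u = <⇒≱ u<v near
    cross-agree-within (suc d) ρ {ρ′} {u} {v} near small s u≁v u<v v<′u = by-side
      (itemAt ρ (≤-<-trans u<v (toℕ<n (ρ ⟨$⟩ʳ v)))) (predecessor ρ u<v)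
      where
      near′ : pos ρ v ≤ d + suc (pos ρ u)
      near′ = ≤-trans near (≤-reflexive (sym (+-suc d (pos ρ u))))

      v≢u : v ≢ u
      v≢u = inA-≢ (u≁v ∘ sym)

      same-side-successor : ∀ {w} → pos ρ w ≡ suc (pos ρ u) → inA u ≡ inA w → ⊥
      same-side-successor {w} pos-w u~w with <-cmp (pos ρ′ u) (pos ρ′ w)
      ... | tri< u<′w _ _ = cross-agree-within d ρ
        (≤-trans near′ (≤-reflexive (cong (d +_) (sym pos-w)))) small s (u≁v ∘ ≡-trans u~w)
        (≤∧≢⇒< (≤-trans (≤-reflexive pos-w) u<v) (inA-≢ (u≁v ∘ ≡-trans u~w) ∘ pos-injective ρ))
        (<-trans v<′u u<′w)
      ... | tri≈ _ u≡′w _ = contradiction (≡-trans (cong (pos ρ) (pos-injective ρ′ u≡′w)) pos-w) (<⇒≢ (n<1+n _))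
      ... | tri> _ _ w<′u = cross-agree-within d (exchange ρ u w)
        (≤-trans (≤-reflexive pos-v) (≤-trans near′ (≤-reflexive (cong (d +_) (sym (≡-trans pos-u pos-w))))))
        (≤-trans (≤-reflexive (cong (λ k → 2 + 2 * k) (X-exchange-same ρ u w pos-w u~w))) small)
        (SameLeaf-exchange ρ u w pos-w t w<′u s) u≁v
        (≤-trans (s≤s (≤-reflexive (≡-trans pos-u pos-w)))
          (≤-trans (≤∧≢⇒< u<v (v≢w ∘ pos-injective ρ ∘ sym ∘ ≡-trans pos-w)) (≤-reflexive (sym pos-v))))
        v<′u
        where
        v≢w : v ≢ w
        v≢w = inA-≢ λ v~w → u≁v (≡-trans u~w (sym v~w))
        pos-u = pos-exchange₁ ρ u w
        pos-v = pos-exchange-other ρ u w v≢u v≢w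

      same-side-predecessor : ∀ {z} → pos ρ v ≡ suc (pos ρ z) → inA z ≡ inA v → ⊥
      same-side-predecessor {z} pos-v z~v with <-cmp (pos ρ′ z) (pos ρ′ v)
      ... | tri< z<′v _ _ = cross-agree-within d ρ
        (≤-pred (≤-trans (≤-reflexive (sym pos-v)) near)) small s (λ u~z → u≁v (≡-trans u~z z~v))
        u<z
        (<-trans z<′v v<′u)
        where
        u<z : pos ρ u < pos ρ z
        u<z = ≤∧≢⇒< (≤-pred (≤-trans u<v (≤-reflexive pos-v)))
          (inA-≢ (λ u~z → u≁v (≡-trans u~z z~v)) ∘ pos-injective ρ)
      ... | tri≈ _ z≡′v _ = contradiction (≡-trans (cong (pos ρ) (pos-injective ρ′ z≡′v)) pos-v) (<⇒≢ (n<1+n _))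
      ... | tri> _ _ v<′z = cross-agree-within d (exchange ρ z v)
        (≤-trans (≤-reflexive pos′-v) (≤-trans (≤-pred (≤-trans (≤-reflexive (sym pos-v)) near)) (≤-reflexive (cong (d +_) (sym pos′-u)))))
        (≤-trans (≤-reflexive (cong (λ k → 2 + 2 * k) (X-exchange-same ρ z v pos-v z~v))) small)
        (SameLeaf-exchange ρ z v pos-v t v<′z s) u≁v
        (≤-trans (s≤s (≤-reflexive pos′-u)) (≤-trans u<z (≤-reflexive (sym pos′-v))))
        v<′u
        where
        u≢z : u ≢ z
        u≢z = inA-≢ λ u~z → u≁v (≡-trans u~z z~v)
        u<z : pos ρ u < pos ρ z
        u<z = ≤∧≢⇒< (≤-pred (≤-trans u<v (≤-reflexive pos-v))) (u≢z ∘ pos-injective ρ)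
        pos′-v = pos-exchange₂ ρ z v
        pos′-u = pos-exchange-other ρ z v u≢z (v≢u ∘ sym)

      by-side : (∃ λ w → pos ρ w ≡ suc (pos ρ u)) → (∃ λ z → pos ρ v ≡ suc (pos ρ z)) → ⊥
      by-side (w , pos-w) (z , pos-v) with inA u Bool.≟ inA w | inA z Bool.≟ inA v
      ... | yes u~w | _       = same-side-successor pos-w u~w
      ... | no _    | yes z~v = same-side-predecessor pos-v z~v
      ... | no u≁w  | no z≁v  = cross-agree-within d ρ
        (≤-trans (≤-trans (n≤1+n _) (≤-reflexive (sym pos-v))) (≤-trans near′ (≤-reflexive (cong (d +_) (sym pos-w)))))
        small s w≁z w<z (<-trans z<′v (<-trans v<′u u<′w))
        where
        u<′w : pos ρ′ u < pos ρ′ w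
        u<′w = ≤∧≢⇒< (≮⇒≥ (adjacent-cross-agree small s u≁w pos-w)) (inA-≢ u≁w ∘ pos-injective ρ′)
        z<′v : pos ρ′ z < pos ρ′ v
        z<′v = ≤∧≢⇒< (≮⇒≥ (adjacent-cross-agree small s z≁v pos-v)) (inA-≢ z≁v ∘ pos-injective ρ′)
        -- With only two sides, `z` differs from `v` and so lies with `u`, whereas `w` does not.
        w≁z : inA w ≢ inA z
        w≁z w~z = u≁w (≡-trans (Bool.¬-not u≁v) (≡-trans (sym (Bool.¬-not z≁v)) (sym w~z)))
        -- If `u` and `v` were adjacent, `u<′w` would contradict `v<′u`.
        w≢v : w ≢ v
        w≢v refl = <-asym v<′u u<′w
        w<z : pos ρ w < pos ρ z
        w<z = ≤∧≢⇒<
          (≤-pred (≤-trans (≤∧≢⇒< (≤-trans (≤-reflexive pos-w) u<v) (w≢v ∘ pos-injective ρ)) (≤-reflexive pos-v)))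
          (inA-≢ w≁z ∘ pos-injective ρ)

    -- Smallness is asked of `ρ` alone: all exchanges are made on `ρ`, while `ρ′` stays fixed as the
    -- target.
    cross-agree : ∀ {ρ ρ′ u v} → 2 + 2 * X ρ ≤ a * b → SameLeaf t ρ ρ′ →
      inA u ≢ inA v → pos ρ u < pos ρ v → ¬ (pos ρ′ v < pos ρ′ u)
    -- The rank of `v` is a crude bound on its distance from `u`.
    cross-agree {ρ} {v = v} = cross-agree-within (pos ρ v) ρ (m≤m+n _ _)

-- The ranking in which the items of A appear in their given order and exactly g j of
-- them lie above the j-th item of B.
module GapRanking {a b K : ℕ} (g : Fin b → Fin K) where

  -- The number of items of A below the `j`-th item of B: those with index less than `cut j`.
  cut : Fin b → ℕ
  cut j = a ∸ toℕ (g j)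

  -- Lexicographic: A-item i is (i , b), B-item j is (cut j , j), coded in base 1 + b.
  keyA : Fin a → ℕ
  keyA i = b + toℕ i * suc b

  keyB : Fin b → ℕ
  keyB j = toℕ j + cut j * suc b

  keyA<keyB : ∀ {i j} → toℕ i < cut j → keyA i < keyB j
  keyA<keyB {i} {j} i<c = ≤-trans (*-monoˡ-≤ (suc b) i<c) (m≤n+m (cut j * suc b) (toℕ j))

  -- If the first coordinates tie, the second decides: `toℕ j < b` puts the B-item first.
  keyB<keyA : ∀ {i j} → cut j ≤ toℕ i → keyB j < keyA i
  keyB<keyA {i} {j} c≤i = +-mono-<-≤ (toℕ<n j) (*-monoˡ-≤ (suc b) c≤i)

  keyA≢keyB : ∀ {i j} → keyA i ≢ keyB j
  keyA≢keyB {i} {j} eq with ≤-<-connex (cut j) (toℕ i)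
  ... | inj₁ c≤i = <⇒≢ (keyB<keyA {i} {j} c≤i) (sym eq)
  ... | inj₂ i<c = <⇒≢ (keyA<keyB {i} {j} i<c) eq

  keyA-injective : ∀ {i i′} → keyA i ≡ keyA i′ → i ≡ i′
  keyA-injective {i} {i′} eq = toℕ-injective (*-cancelʳ-≡ (toℕ i) (toℕ i′) (suc b) (+-cancelˡ-≡ b _ _ eq))

  keyB-injective : ∀ {j j′} → keyB j ≡ keyB j′ → j ≡ j′
  keyB-injective {j} {j′} eq = toℕ-injective (begin
    toℕ j             ≡⟨ keyB-mod j ⟨
    keyB j % suc b    ≡⟨ cong (_% suc b) eq ⟩
    keyB j′ % suc b   ≡⟨ keyB-mod j′ ⟩
    toℕ j′            ∎)
    where
    open ≡-Reasoning
    -- The residue modulo `suc b` recovers the second coordinate, because `toℕ j < suc b`.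
    keyB-mod : ∀ j → keyB j % suc b ≡ toℕ j
    keyB-mod j = ≡-trans ([m+kn]%n≡m%n (toℕ j) (cut j) (suc b)) (m<n⇒m%n≡m (m<n⇒m<1+n (toℕ<n j)))

  key : Fin (a + b) → ℕ
  key x = [ keyA , keyB ]′ (splitAt a x)

  key-↑ˡ : ∀ i → key (i ↑ˡ b) ≡ keyA i
  key-↑ˡ i = cong [ keyA , keyB ]′ (splitAt-↑ˡ a i b)

  key-↑ʳ : ∀ j → key (a ↑ʳ j) ≡ keyB j
  key-↑ʳ j = cong [ keyA , keyB ]′ (splitAt-↑ʳ a b j)

  key-injective : ∀ {x y} → key x ≡ key y → x ≡ y
  key-injective {x} {y} eq with splitAt a x in x? | splitAt a y in y?
  ... | inj₁ i | inj₁ i′ = ≡-trans (sym (splitAt⁻¹-↑ˡ x?)) (≡-trans (cong (_↑ˡ b) (keyA-injective eq)) (splitAt⁻¹-↑ˡ y?))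
  ... | inj₁ i | inj₂ j  = contradiction eq (keyA≢keyB {i} {j})
  ... | inj₂ j | inj₁ i  = contradiction (sym eq) (keyA≢keyB {i} {j})
  ... | inj₂ j | inj₂ j′ = ≡-trans (sym (splitAt⁻¹-↑ʳ {a} x?)) (≡-trans (cong (a ↑ʳ_) (keyB-injective eq)) (splitAt⁻¹-↑ʳ {a} y?))

  open KeyRanking key key-injective public

  A-below-B : ∀ {i j} → toℕ i < cut j → pos ranking (i ↑ˡ b) < pos ranking (a ↑ʳ j)
  A-below-B {i} {j} i<c = pos-mono (subst₂ _<_ (sym (key-↑ˡ i)) (sym (key-↑ʳ j)) (keyA<keyB i<c))

  B-below-A : ∀ {i j} → cut j ≤ toℕ i → pos ranking (a ↑ʳ j) < pos ranking (i ↑ˡ b)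
  B-below-A {i} {j} c≤i = pos-mono (subst₂ _<_ (sym (key-↑ʳ j)) (sym (key-↑ˡ i)) (keyB<keyA c≤i))

  -- Since every `g j` is less than `K`, only the last `K` items of A can have items of B below
  -- them, and each has at most `b`.
  XInv-bound : XInv ranking (itemsA a b) (itemsB a b) ≤ K * b
  XInv-bound = begin
    XInv ranking (itemsA a b) (itemsB a b)  ≡⟨ XInv-∑ a b ranking ⟩
    ∑ {a} (λ i → ∑ {b} (λ j → inverted i j)) ≤⟨ ∑-tail-bound K b
      (λ i → ≤-trans (∑-bound 1 (λ j → ⟦⟧≤1 ((a ↑ʳ j) ≺[ ranking ] (i ↑ˡ b)))) (≤-reflexive (*-identityʳ b)))
      (λ i K+i<a → ≡-trans (∑-cong {b} (no-inversion i K+i<a)) (≡-trans (∑-const b 0) (*-zeroʳ b))) ⟩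
    K * b                                   ∎
    where
    open ≤-Reasoning
    inverted : Fin a → Fin b → ℕ
    inverted i j = ⟦ (a ↑ʳ j) ≺[ ranking ] (i ↑ˡ b) ⟧
    no-inversion : ∀ i → K + toℕ i < a → ∀ j → inverted i j ≡ 0
    no-inversion i K+i<a j = cong ⟦_⟧ (<ᵇ-false (<⇒≤ (A-below-B (m+n≤o⇒m≤o∸n (suc (toℕ i)) (begin
      suc (toℕ i) + toℕ (g j) ≤⟨ +-monoʳ-≤ (suc (toℕ i)) (<⇒≤ (toℕ<n (g j))) ⟩
      suc (toℕ i) + K         ≡⟨ cong suc (+-comm (toℕ i) K) ⟩
      suc (K + toℕ i)         ≤⟨ K+i<a ⟩
      a                       ∎)))))

-- Counting the gap rankings

funToFin-cong : ∀ {m n} {f f′ : Fin m → Fin n} → (∀ i → f i ≡ f′ i) → funToFin f ≡ funToFin f′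
funToFin-cong {zero}  f≗f′ = refl
funToFin-cong {suc m} f≗f′ = cong₂ combine (f≗f′ zero) (funToFin-cong (f≗f′ ∘ suc))

-- Lets `Fin (K ^ b)` enumerate the placements without repetition, where placements are compared
-- pointwise.
finToFun-injective : ∀ {K b} {i j : Fin (K ^ b)} → (∀ l → finToFun {K} {b} i l ≡ finToFun j l) → i ≡ j
finToFun-injective {K} {b} {i} {j} eq =
  ≡-trans (sym (funToFin-finToFin {b} {K} i)) (≡-trans (funToFin-cong eq) (funToFin-finToFin {b} {K} j))

module _ (a b k : ℕ) (1≤b : 1 ≤ b) (4K≤a : 4 * 2 ^ k ≤ a) (t : DecTree (a + b) ℕ)
  (correct : ∀ ρ → 2 * XInv ρ (itemsA a b) (itemsB a b) ≤ a * b → run t ρ ≡ XInv ρ (itemsA a b) (itemsB a b)) where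

  open Cross a b
  open GapRanking

  private
    K = 2 ^ k

    gapRanking : (Fin b → Fin K) → Ranking (a + b)
    gapRanking g = ranking {a} g

    -- Half of `4 * (K * b)` bounds twice the cross inversions; the other half is at least 2 and
    -- provides the slack for `cross-agree`.
    X-small : ∀ g → 2 + 2 * X (gapRanking g) ≤ a * b
    X-small g = begin
      2 + 2 * X (gapRanking g)     ≤⟨ +-mono-≤ (*-monoʳ-≤ 2 (*-mono-≤ (m^n>0 2 k) 1≤b)) (*-monoʳ-≤ 2 (XInv-bound {a} g)) ⟩
      2 * (K * b) + 2 * (K * b)    ≡⟨ *-distribʳ-+ (K * b) 2 2 ⟨
      4 * (K * b)                  ≡⟨ *-assoc 4 K b ⟨
      4 * K * b                    ≤⟨ *-monoˡ-≤ b 4K≤a ⟩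
      a * b                        ∎
      where open ≤-Reasoning

    -- If `g j < g′ j`, the A-item with index `cut g′ j` lies below the `j`-th B-item for `g` but
    -- above it for `g′`, contradicting `cross-agree`.
    gap-≤ : ∀ g g′ → SameLeaf t (gapRanking g) (gapRanking g′) → ∀ j → toℕ (g′ j) ≤ toℕ (g j)
    gap-≤ g g′ s j = ≮⇒≥ λ gj<g′j →
      -- This bound ensures that the subtraction in `cut` is not truncated, so that it is strictly
      -- antitone.
      let g′j≤a = ≤-trans (<⇒≤ (toℕ<n (g′ j))) (≤-trans (m≤m+n K (3 * K)) 4K≤a)
          cut′<cut : cut {a} g′ j < cut {a} g j
          cut′<cut = ∸-monoʳ-< gj<g′j g′j≤a
          cut′<a = <-≤-trans cut′<cut (m∸n≤m a (toℕ (g j)))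
          i≡cut′ = toℕ-fromℕ< cut′<a
      in cross-agree t correct {u = fromℕ< cut′<a ↑ˡ b} {v = a ↑ʳ j} (X-small g) s
        (λ eq → contradiction (≡-trans (sym (inA-↑ˡ (fromℕ< cut′<a))) (≡-trans eq (inA-↑ʳ j))) λ ())
        (A-below-B g (≤-trans (s≤s (≤-reflexive i≡cut′)) cut′<cut))
        (B-below-A g′ (≤-reflexive (sym i≡cut′)))

    gap-≡ : ∀ g g′ → SameLeaf t (gapRanking g) (gapRanking g′) → ∀ j → g j ≡ g′ j
    gap-≡ g g′ s j = toℕ-injective (≤-antisym (gap-≤ g′ g (SameLeaf-sym t s) j) (gap-≤ g g′ s j))

    rankings : List (Ranking (a + b))
    rankings = tabulate {n = K ^ b} (λ i → gapRanking (finToFun i))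

  query-lower-bound : ∃ λ ρ → k * b ≤ queries t ρ
  query-lower-bound = worst-case-lower-bound t id rankings
    -- There are `K ^ b = (2 ^ k) ^ b = 2 ^ (k * b)` placements.
    (≤-reflexive (≡-trans (sym (^-*-assoc 2 k b)) (sym (length-tabulate _))))
    (AllPairs.tabulate⁺ λ {i} {j} i≢j s → i≢j (finToFun-injective {K} {b} (gap-≡ (finToFun i) (finToFun j) s)))

-- Logarithms and the choice of constants

2^⌊log₂⌋≤ : ∀ n → 1 ≤ n → 2 ^ ⌊log₂ n ⌋ ≤ n
2^⌊log₂⌋≤ = <-rec (λ n → 1 ≤ n → 2 ^ ⌊log₂ n ⌋ ≤ n) step
  where
  step : ∀ n → (∀ {m} → m < n → 1 ≤ m → 2 ^ ⌊log₂ m ⌋ ≤ m) → 1 ≤ n → 2 ^ ⌊log₂ n ⌋ ≤ n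
  step 1 rec _ = ≤-refl
  step n@(suc (suc m)) rec _ = begin
    2 ^ ⌊log₂ n ⌋                  ≡⟨ cong (2 ^_) (m+[n∸m]≡n {1} (⌊log₂⌋-mono-≤ {2} {n} (s≤s (s≤s z≤n)))) ⟨
    2 * 2 ^ (⌊log₂ n ⌋ ∸ 1)        ≡⟨ cong (λ l → 2 * 2 ^ l) (⌊log₂⌊n/2⌋⌋≡⌊log₂n⌋∸1 n) ⟨
    2 * 2 ^ ⌊log₂ ⌊ n /2⌋ ⌋        ≤⟨ *-monoʳ-≤ 2 (rec (⌊n/2⌋<n (suc m)) (s≤s z≤n)) ⟩
    2 * ⌊ n /2⌋                    ≡⟨ cong (⌊ n /2⌋ +_) (+-identityʳ ⌊ n /2⌋) ⟩
    ⌊ n /2⌋ + ⌊ n /2⌋              ≤⟨ +-monoʳ-≤ ⌊ n /2⌋ (⌊n/2⌋≤⌈n/2⌉ n) ⟩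
    ⌊ n /2⌋ + ⌈ n /2⌉              ≡⟨ ⌊n/2⌋+⌈n/2⌉≡n n ⟩
    n                              ∎
    where open ≤-Reasoning

lower-bound : ∀ a b → 16 ≤ a → a ≤ b → (t : DecTree (a + b) ℕ) →
  (∀ ρ → 2 * XInv ρ (itemsA a b) (itemsB a b) ≤ a * b → run t ρ ≡ XInv ρ (itemsA a b) (itemsB a b)) →
  ∃ λ ρ → (a + b) * ⌊log₂ a ⌋ ≤ 4 * queries t ρ
lower-bound a b 16≤a a≤b t correct =
  let ρ , kb≤q = query-lower-bound a b k (≤-trans 1≤a a≤b) 4K≤a t correct
  in ρ , (begin
    -- One factor 2 comes from `a ≤ b`, the other from `log≤2k`; together they give the constant 4.
    (a + b) * ⌊log₂ a ⌋    ≤⟨ *-mono-≤ (+-monoˡ-≤ b a≤b) log≤2k ⟩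
    (b + b) * (2 * k)      ≡⟨ cong (λ c → (b + c) * (2 * k)) (+-identityʳ b) ⟨
    2 * b * (2 * k)        ≡⟨ [m*n]*[o*p]≡[m*o]*[n*p] 2 b 2 k ⟩
    4 * (b * k)            ≡⟨ cong (4 *_) (*-comm b k) ⟩
    4 * (k * b)            ≤⟨ *-monoʳ-≤ 4 kb≤q ⟩
    4 * queries t ρ        ∎)
  where
  open ≤-Reasoning
  -- Subtracting 2 divides the power by 4, which gives `4 * 2 ^ k ≤ a`.
  k = ⌊log₂ a ⌋ ∸ 2
  1≤a : 1 ≤ a
  1≤a = ≤-trans (s≤s z≤n) 16≤a
  -- The threshold 16 enters here: a logarithm of at least 4 keeps at least half of its value after
  -- 2 is subtracted.
  4≤log : 4 ≤ ⌊log₂ a ⌋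
  4≤log = ⌊log₂⌋-mono-≤ 16≤a
  2+k≡log : 2 + k ≡ ⌊log₂ a ⌋
  2+k≡log = m+[n∸m]≡n (≤-trans (s≤s (s≤s z≤n)) 4≤log)
  log≤2k : ⌊log₂ a ⌋ ≤ 2 * k
  log≤2k = begin
    ⌊log₂ a ⌋  ≡⟨ 2+k≡log ⟨
    2 + k      ≤⟨ +-monoˡ-≤ k (∸-monoˡ-≤ 2 4≤log) ⟩
    k + k      ≡⟨ cong (k +_) (+-identityʳ k) ⟨
    2 * k      ∎
  4K≤a : 4 * 2 ^ k ≤ a
  4K≤a = begin
    4 * 2 ^ k        ≡⟨ *-assoc 2 2 (2 ^ k) ⟩
    2 ^ (2 + k)      ≡⟨ cong (2 ^_) 2+k≡log ⟩
    2 ^ ⌊log₂ a ⌋    ≤⟨ 2^⌊log₂⌋≤ a 1≤a ⟩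
    a                ∎

-- Inversions of the two-star tree

countB-++ : ∀ {X : Set} (p : X → Bool) xs ys → countB p (xs ++ ys) ≡ countB p xs + countB p ys
countB-++ p [] ys = refl
countB-++ p (x ∷ xs) ys with p x
... | true  = cong suc (countB-++ p xs ys)
... | false = countB-++ p xs ys

countB-↭ : ∀ {X : Set} (p : X → Bool) {xs ys} → xs ↭ ys → countB p xs ≡ countB p ys
countB-↭ p refl = refl
countB-↭ p (prep x xs↭ys) with p x
... | true  = cong suc (countB-↭ p xs↭ys)
... | false = countB-↭ p xs↭ys
countB-↭ p (swap x y xs↭ys) with p x | p y
... | true  | true  = cong (2 +_) (countB-↭ p xs↭ys)
... | true  | false = cong suc (countB-↭ p xs↭ys)
... | false | true  = cong suc (countB-↭ p xs↭ys)
... | false | false = countB-↭ p xs↭ys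
countB-↭ p (trans xs↭ys ys↭zs) = ≡-trans (countB-↭ p xs↭ys) (countB-↭ p ys↭zs)

countB-none : ∀ {X : Set} (p : X → Bool) {xs} → All (λ x → p x ≡ false) xs → countB p xs ≡ 0
countB-none p [] = refl
countB-none p (px ∷ pxs) rewrite px = countB-none p pxs

↭-pair-inv : ∀ {X : Set} {x y : X} {zs} → x ∷ y ∷ [] ↭ zs → zs ≡ x ∷ y ∷ [] ⊎ zs ≡ y ∷ x ∷ []
↭-pair-inv refl = inj₁ refl
↭-pair-inv (prep x p) with refl ← ↭-singleton-inv (↭-sym p) = inj₁ refl
↭-pair-inv (swap x y p) with refl ← ↭-empty-inv (↭-sym p) = inj₂ refl
↭-pair-inv (trans p q) with ↭-pair-inv p
... | inj₁ refl = ↭-pair-inv q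
... | inj₂ refl with ↭-pair-inv q
...   | inj₁ eq = inj₂ eq
...   | inj₂ eq = inj₁ eq

frontierL-lf : ∀ {X : Set} (xs : List X) → frontierL (map lf xs) ≡ xs
frontierL-lf []       = refl
frontierL-lf (x ∷ xs) = cong (x ∷_) (frontierL-lf xs)

Reordering-lf : ∀ {X : Set} {xs : List X} {us} → Pointwise Reordering (map lf xs) us → us ≡ map lf xs
Reordering-lf {xs = []}     []            = refl
Reordering-lf {xs = x ∷ xs} (lf .x ∷ rs) = cong (lf x ∷_) (Reordering-lf rs)

-- The children are leaves and reorder only to themselves, so only the permutation at the root
-- remains.
Reordering-star : ∀ {X : Set} {xs : List X} {t} → Reordering (node (map lf xs)) t → xs ↭ frontier t
Reordering-star (node rs us↭vs) with refl ← Reordering-lf rs with zs , refl , xs↭zs ← ↭-map-inv lf us↭vs =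
  subst (_ ↭_) (sym (frontierL-lf zs)) xs↭zs

star-Reordering : ∀ {X : Set} {xs ys : List X} → xs ↭ ys → Reordering (node (map lf xs)) (node (map lf ys))
star-Reordering {xs = xs} xs↭ys = node (lfs xs) (map⁺ lf xs↭ys)
  where
  lfs : ∀ xs → Pointwise Reordering (map lf xs) (map lf xs)
  lfs []       = []
  lfs (x ∷ xs) = lf x ∷ lfs xs

-- Inversions of concatenations and complementary cross inversions

module _ {n} (ρ : Ranking n) where

  -- `invs` compares each entry with the later ones, so an inversion across the seam is a cross
  -- inversion from `xs` to `ys`.
  invs-++ : ∀ xs ys → invs ρ (xs ++ ys) ≡ XInv ρ xs ys + (invs ρ xs + invs ρ ys)
  invs-++ [] ys = refl
  invs-++ (x ∷ xs) ys = begin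
    countB p (xs ++ ys) + invs ρ (xs ++ ys)
      ≡⟨ cong₂ _+_ (≡-trans (countB-++ p xs ys) (+-comm (countB p xs) (countB p ys))) (invs-++ xs ys) ⟩
    (countB p ys + countB p xs) + (XInv ρ xs ys + (invs ρ xs + invs ρ ys))
      ≡⟨ interchange (countB p ys) (countB p xs) (XInv ρ xs ys) (invs ρ xs + invs ρ ys) ⟩
    (countB p ys + XInv ρ xs ys) + (countB p xs + (invs ρ xs + invs ρ ys))
      ≡⟨ cong (XInv ρ (x ∷ xs) ys +_) (+-assoc (countB p xs) (invs ρ xs) (invs ρ ys)) ⟨
    XInv ρ (x ∷ xs) ys + (invs ρ (x ∷ xs) + invs ρ ys) ∎
    where
    open ≡-Reasoning
    p = _≺[ ρ ] x

  XInv≤invs : ∀ xs ys → XInv ρ xs ys ≤ invs ρ (xs ++ ys)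
  XInv≤invs xs ys = ≤-trans (m≤m+n _ _) (≤-reflexive (sym (invs-++ xs ys)))

  XInv-↭ : ∀ {xs xs′ ys ys′} → xs ↭ xs′ → ys ↭ ys′ → XInv ρ xs ys ≡ XInv ρ xs′ ys′
  XInv-↭ {xs} {xs′} {ys} {ys′} xs↭ ys↭ = ≡-trans
    (sum-↭ (map⁺ (λ x → countB (_≺[ ρ ] x) ys) xs↭))
    (cong sum (map-cong (λ x → countB-↭ (_≺[ ρ ] x) ys↭) xs′))

  countB-≺+≻ : ∀ x {ys} → All (x ≢_) ys → countB (_≺[ ρ ] x) ys + countB (x ≺[ ρ ]_) ys ≡ length ys
  countB-≺+≻ x [] = refl
  countB-≺+≻ x {y ∷ ys} (x≢y ∷ x≢ys) with <-cmp (pos ρ x) (pos ρ y)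
  ... | tri< x<y _ _ rewrite <ᵇ-true x<y | <ᵇ-false (<⇒≤ x<y) = ≡-trans (+-suc _ _) (cong suc (countB-≺+≻ x x≢ys))
  ... | tri≈ _ x≡y _ = contradiction (pos-injective ρ x≡y) x≢y
  ... | tri> _ _ y<x rewrite <ᵇ-true y<x | <ᵇ-false (<⇒≤ y<x) = cong suc (countB-≺+≻ x x≢ys)

  -- `XInv` recurses on its first list; this is the matching recursion on the second, for use in
  -- `XInv-complement`.
  XInv-∷ʳ : ∀ x xs ys → XInv ρ ys (x ∷ xs) ≡ countB (x ≺[ ρ ]_) ys + XInv ρ ys xs
  XInv-∷ʳ x xs [] = refl
  XInv-∷ʳ x xs (y ∷ ys) rewrite XInv-∷ʳ x xs ys with x ≺[ ρ ] y
  ... | true  = cong suc (x∙yz≈y∙xz (countB (_≺[ ρ ] y) xs) (countB (x ≺[ ρ ]_) ys) (XInv ρ ys xs))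
  ... | false = x∙yz≈y∙xz (countB (_≺[ ρ ] y) xs) (countB (x ≺[ ρ ]_) ys) (XInv ρ ys xs)

  XInv-[] : ∀ ys → XInv ρ ys [] ≡ 0
  XInv-[] []       = refl
  XInv-[] (y ∷ ys) = XInv-[] ys

  -- Distinct items have distinct ranks, so each pair is inverted in exactly one of the two
  -- directions.
  XInv-complement : ∀ {xs ys} → All (λ x → All (x ≢_) ys) xs → XInv ρ xs ys + XInv ρ ys xs ≡ length xs * length ys
  XInv-complement {ys = ys} [] = XInv-[] ys
  XInv-complement {x ∷ xs} {ys} (x≢ys ∷ xs≢ys) = begin
    (countB (_≺[ ρ ] x) ys + XInv ρ xs ys) + XInv ρ ys (x ∷ xs)
      ≡⟨ cong (XInv ρ (x ∷ xs) ys +_) (XInv-∷ʳ x xs ys) ⟩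
    (countB (_≺[ ρ ] x) ys + XInv ρ xs ys) + (countB (x ≺[ ρ ]_) ys + XInv ρ ys xs)
      ≡⟨ interchange (countB (_≺[ ρ ] x) ys) (XInv ρ xs ys) (countB (x ≺[ ρ ]_) ys) (XInv ρ ys xs) ⟩
    (countB (_≺[ ρ ] x) ys + countB (x ≺[ ρ ]_) ys) + (XInv ρ xs ys + XInv ρ ys xs)
      ≡⟨ cong₂ _+_ (countB-≺+≻ x x≢ys) (XInv-complement xs≢ys) ⟩
    length ys + length xs * length ys ∎
    where open ≡-Reasoning

  byPosition : DecTotalOrder _ _ _
  byPosition = On.decTotalOrder ≤-decTotalOrder (pos ρ)

  open Sort byPosition using (sort; sort-↗)

  invs-sorted : ∀ {xs} → AllPairs (λ x y → pos ρ x ≤ pos ρ y) xs → invs ρ xs ≡ 0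
  invs-sorted [] = refl
  invs-sorted (x≤xs ∷ xs↗) = cong₂ _+_ (countB-none _ (All.map <ᵇ-false x≤xs)) (invs-sorted xs↗)

  invs-sort : ∀ xs → invs ρ (sort xs) ≡ 0
  invs-sort xs = invs-sorted (Sorted⇒AllPairs (DecTotalOrder.totalOrder byPosition) (sort-↗ xs))

-- The minimum for the two-star tree

module _ {a b : ℕ} (ρ : Ranking (a + b)) where

  private
    A = itemsA a b
    B = itemsB a b

  A-disjoint-B : All (λ x → All (x ≢_) B) A
  A-disjoint-B = All.map⁺ (All.tabulate⁺ λ i → All.map⁺ (All.tabulate⁺ λ j eq →
    contradiction (≡-trans (sym (Cross.inA-↑ˡ a b i)) (≡-trans (cong (Cross.inA a b) eq) (Cross.inA-↑ʳ a b j))) λ ()))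

  XInv-A-B+XInv-B-A : XInv ρ A B + XInv ρ B A ≡ a * b
  XInv-A-B+XInv-B-A = ≡-trans (XInv-complement ρ A-disjoint-B) (cong₂ _*_
    (≡-trans (length-map _ (allFin a)) (length-tabulate {n = a} _))
    (≡-trans (length-map _ (allFin b)) (length-tabulate {n = b} _)))

  -- Sorting the leaves of each star by rank removes all inner inversions; with A kept on the left,
  -- only the cross inversions remain.
  MInv-upper-bound : ∃ λ t → Reordering (twoStar a b) t × invs ρ (frontier t) ≡ XInv ρ A B
  MInv-upper-bound =
    node (node (map lf (sort A)) ∷ node (map lf (sort B)) ∷ []) ,
    node (star-Reordering (↭-sym (sort-↭ A)) ∷ star-Reordering (↭-sym (sort-↭ B)) ∷ []) refl ,
    (begin
      invs ρ (frontierL (map lf (sort A)) ++ (frontierL (map lf (sort B)) ++ []))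
        ≡⟨ cong (invs ρ) (cong₂ _++_ (frontierL-lf (sort A)) (≡-trans (++-identityʳ _) (frontierL-lf (sort B)))) ⟩
      invs ρ (sort A ++ sort B)
        ≡⟨ invs-++ ρ (sort A) (sort B) ⟩
      XInv ρ (sort A) (sort B) + (invs ρ (sort A) + invs ρ (sort B))
        ≡⟨ cong₂ _+_ (XInv-↭ ρ (sort-↭ A) (sort-↭ B)) (cong₂ _+_ (invs-sort ρ A) (invs-sort ρ B)) ⟩
      XInv ρ A B + 0
        ≡⟨ +-identityʳ _ ⟩
      XInv ρ A B ∎)
    where
    open ≡-Reasoning
    open Sort (byPosition ρ) using (sort; sort-↭)

  -- The root has two orders. With A on the left the cross inversions alone suffice; with B on the
  -- left there are `a * b ∸ XInv ρ A B` of them, which is no fewer by smallness.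
  MInv-lower-bound : 2 * XInv ρ A B ≤ a * b → ∀ t → Reordering (twoStar a b) t → XInv ρ A B ≤ invs ρ (frontier t)
  MInv-lower-bound small _ (node (_∷_ {y = tA} rA (_∷_ {y = tB} rB [])) ts↭) with ↭-pair-inv ts↭
  ... | inj₁ refl = begin
    XInv ρ A B                               ≡⟨ XInv-↭ ρ (Reordering-star rA) (Reordering-star rB) ⟩
    XInv ρ (frontier tA) (frontier tB)       ≤⟨ XInv≤invs ρ (frontier tA) (frontier tB) ⟩
    invs ρ (frontier tA ++ frontier tB)      ≡⟨ cong (λ xs → invs ρ (frontier tA ++ xs)) (++-identityʳ (frontier tB)) ⟨
    invs ρ (frontier tA ++ frontier tB ++ []) ∎
    where
    open ≤-Reasoning
  ... | inj₂ refl = begin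
    XInv ρ A B                               ≤⟨ XInv-A-B≤XInv-B-A ⟩
    XInv ρ B A                               ≡⟨ XInv-↭ ρ (Reordering-star rB) (Reordering-star rA) ⟩
    XInv ρ (frontier tB) (frontier tA)       ≤⟨ XInv≤invs ρ (frontier tB) (frontier tA) ⟩
    invs ρ (frontier tB ++ frontier tA)      ≡⟨ cong (λ xs → invs ρ (frontier tB ++ xs)) (++-identityʳ (frontier tA)) ⟨
    invs ρ (frontier tB ++ frontier tA ++ []) ∎
    where
    open ≤-Reasoning
    XInv-A-B≤XInv-B-A : XInv ρ A B ≤ XInv ρ B A
    XInv-A-B≤XInv-B-A = +-cancelˡ-≤ (XInv ρ A B) _ _ (begin
      XInv ρ A B + XInv ρ A B   ≡⟨ cong (XInv ρ A B +_) (+-identityʳ _) ⟨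
      2 * XInv ρ A B            ≤⟨ small ⟩
      a * b                     ≡⟨ XInv-A-B+XInv-B-A ⟨
      XInv ρ A B + XInv ρ B A   ∎)

  MInv≡XInv : ∀ {m} → 2 * XInv ρ A B ≤ a * b → IsMInv (twoStar a b) ρ m → m ≡ XInv ρ A B
  MInv≡XInv small ((t , r , t≡m) , minimal) with MInv-upper-bound
  ... | t′ , r′ , t′≡X = ≤-antisym
    (≤-trans (minimal t′ r′) (≤-reflexive t′≡X))
    (≤-trans (MInv-lower-bound small t r) (≤-reflexive t≡m))

mainTheorem4 : XInvLowerBound × MInvLowerBound
mainTheorem4 =
  (4 , 16 , λ a b 16≤a a≤b alg correct → lower-bound a b 16≤a a≤b alg (λ ρ _ → correct ρ)) ,
  (4 , 16 , λ a b 16≤a a≤b alg correct → lower-bound a b 16≤a a≤b alg (λ ρ small → MInv≡XInv ρ small (correct ρ)))
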